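{- Let $v=142396857\in S_9$ (one-line notation) and $\gamma=(4,6,3,3,0,0,0,0,0)$. Then $\#\mathrm{PD}(v,\gamma)=1$ and $\#\mathsf{GKKoh}(v,\gamma)\geq 2$.
   Context: Cells of the $n\times n$ grid $[n]\times[n]$ are indexed in matrix notation: $(i,j)$ is row $i$ (counted from the top), column $j$ (counted from the left). Pipe dreams. A pipe dream is a filling of the triangular grid $\{(i,j)\in[n]\times[n]: i+j\leq n\}$ with crossing tiles (a pipe entering from the top exits at the bottom, a pipe entering from the right exits at the left) and bump tiles (a pipe entering from the top exits at the left, a pipe entering from the right exits at the bottom); half-bump tiles (a pipe entering from the top exits at the left) are placed on the antidiagonal $i+j=n+1$. This gives $n$ pipes running from the top edge to the left edge. The permutation of a pipe dream: label the pipes $1,\dots,n$ along the top edge from left to right, trace them downwards and leftwards, ignoring any crossing between two pipes that have already crossed (treat such crossing tiles as bump tiles); the permutation $w$ is given by reading the labels along the left edge from top to bottom, as $w(1)w(2)\cdots w(n)$. (Equivalently, $w$ is the Demazure (0-Hecke) product of the $s_{i+j-1}$ over the crossing tiles $(i,j)$, read row by row from top to bottom and right to left within each row.) $\mathrm{PD}(w)$ is the set of pipe dreams with permutation $w$; $\mathrm{wt}(P)_i$ is the number of crossing tiles in row $i$ of $P$; $\mathrm{PD}(w,\alpha)=\{P\in\mathrm{PD}(w):\mathrm{wt}(P)=\alpha\}$. Rothe diagram. For $w\in S_n$, $D(w)=\{(i,j)\in[n]^2: i<w^{ -1}(j),\ j<w(i)\}$. Grave diagrams and moves. A grave diagram is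 a pair $E=(B,G)$ of disjoint subsets of $[n]\times[n]$; cells of $B$ are boxes, cells of $G$ are ghosts, cells of $B\cup G$ are occupied. Its weight is $\mathrm{wt}(E)_i=\#\{j:(i,j)\in B\cup G\}$. (a) Suppose $(i,j)\in B$ is rightmost among all occupied cells in row $i$; let $i'=\max\{r: 1\leq r<i,\ (r,j)\notin B\cup G\}$; assume $i'$ exists and every occupied cell $(r,j)$ with $i'<r\leq i$ is a box. The ordinary Kohnert move at row $i$ is $(B,G)\mapsto((B\setminus\{(i,j)\})\cup\{(i',j)\},G)$. The $K$-Kohnert move at row $i$ is $(B,G)\mapsto((B\setminus\{(i,j)\})\cup\{(i',j)\},G\cup\{(i,j)\})$. (b) Suppose $(i,j)\in G$ is the rightmost occupied cell in row $i$; let $i'=\max\{r: 1\leq r<i,\ (r,j)\notin B\cup G\}$; assume $i'$ exists and every occupied cell $(r,j)$ with $i'<r<i$ is a ghost. The ghost Kohnert move at row $i$ is $(B,G)\mapsto(B,(G\setminus\{(i,j)\})\cup\{(i',j)\})$. The ghost $K$-Kohnert move at row $i$ is $(B,G)\mapsto(B,G\cup\{(i',j)\})$. $\mathsf{GKKoh}(w)$ is the closure of $(D(w),\varnothing)$ under ordinary, $K$-, ghost, and ghost $K$-Kohnert moves, i.e. the set of all grave diagrams obtainable from $(D(w),\varnothing)$ by finite sequences of such moves, and $\mathsf{GKKoh}(w,\alpha)=\{E\in\mathsf{GKKoh}(w):\mathrm{wt}(E)=\alpha\}$. -}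

module Defs where

open import Data.Bool using (true; false)
open import Data.Fin using (Fin; #_; _<_; _≤_; _<?_; _≟_; combine; remQuot)
open import Data.Fin.Permutation using (Permutation′; permutation; _⟨$⟩ʳ_; _⟨$⟩ˡ_)
open import Data.Fin.Properties using (all?)
open import Data.Fin.Subset using (Subset; _∈_; _∉_; _∩_; _∪_; _-_; ⁅_⁆; ⊥; ∣_∣; Empty)
open import Data.Fin.Subset.Properties using (∉⊥; x∈p∩q⁻)
open import Data.List using (List; []; _∷_; length)
open import Data.List.Membership.Propositional using () renaming (_∈_ to _∈ₗ_)
open import Data.List.Membership.DecPropositional using () renaming (_∈?_ to member?)
open import Data.List.Relation.Unary.All using (All)
open import Data.List.Relation.Unary.Unique.Propositional using (Unique)
open import Data.Nat using (ℕ; zero; suc; _*_)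
open import Data.Product using (∃-syntax; _×_; _,_; proj₁; proj₂)
open import Data.Product.Properties using (≡-dec)
open import Data.Vec using (Vec; []; _∷_; lookup; tabulate; allFin; count)
open import Function using (_⇔_)
open import Level using (Level)
open import Relation.Binary using (DecidableEquality)
open import Relation.Binary.Construct.Closure.ReflexiveTransitive using (Star)
open import Relation.Binary.PropositionalEquality using (_≡_; refl)
open import Relation.Nullary.Decidable using (Dec; yes; no; does; from-yes; _×-dec_; _⊎-dec_)
open import Relation.Unary using (Pred)

private
  variable
    a p : Level
    m n : ℕ

-- Throughout, the index set [n] = {1,…,n} is represented by Fin n, so that
-- every row, column and label is shifted down by one.

-- These count the elements x : A that satisfy P, not the elements of ∃ P, so
-- that different proofs of P x do not count x twice.

HasSize : {A : Set a} → Pred A p → ℕ → Set _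
HasSize P k = ∃[ xs ] (Unique xs × length xs ≡ k × (∀ x → x ∈ₗ xs ⇔ P x))

HasSizeAtLeast : {A : Set a} → Pred A p → ℕ → Set _
HasSizeAtLeast P k = ∃[ xs ] (Unique xs × length xs ≡ k × All P xs)

data Tile : Set where
  cross bump : Tile

_≟ᵗ_ : DecidableEquality Tile
cross ≟ᵗ cross = yes refl
cross ≟ᵗ bump  = no λ ()
bump  ≟ᵗ cross = no λ ()
bump  ≟ᵗ bump  = yes refl

-- A filling of the cells i + j ≤ n: the top row has n - 1 tiles, the next one
-- n - 2, …, the last one none.  Tiles in a row are listed from left to right;
-- the half-bump at the right end of every row is left implicit.
infixr 5 _∷_
data PipeDream : ℕ → Set where
  []  : PipeDream 0
  _∷_ : Vec Tile n → PipeDream n → PipeDream (suc n)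

Pipe : ℕ → Set
Pipe = Fin

-- The pairs of pipes that have already crossed, each in either order.
Crossings : ℕ → Set
Crossings m = List (Pipe m × Pipe m)

crossed? : (s t : Pipe m) (C : Crossings m) → Dec _
crossed? s t C = member? (≡-dec _≟_ _≟_) (s , t) C ⊎-dec member? (≡-dec _≟_ _≟_) (t , s) C

-- The pipe `top` enters from the top and `right` from the right.  The result
-- is the updated record of crossings, the pipe exiting at the left and the
-- pipe exiting at the bottom.  A crossing of two pipes that have already
-- crossed acts as a bump.
traceTile : Crossings m → Tile → (top right : Pipe m) → Crossings m × Pipe m × Pipe m
traceTile C bump  top right = C , top , right
traceTile C cross top right with does (crossed? top right C)
... | true  = C , top , right
... | false = (top , right) ∷ C , right , top

-- The pipes entering a row from the top, left to right, are sent to the pipe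
-- exiting the row at the left and the pipes exiting at the bottom.  The tiles
-- are traversed from right to left, starting with the half-bump.
traceRow : Crossings m → Vec (Pipe m) (suc n) → Vec Tile n → Crossings m × Pipe m × Vec (Pipe m) n
traceRow C (top ∷ [])   []             = C , top , []
traceRow C (top ∷ tops) (tile ∷ tiles) =
  let C′  , right , bottoms = traceRow C tops tiles
      C″ , left  , bottom  = traceTile C′ tile top right
  in  C″ , left , bottom ∷ bottoms

traceRows : Crossings m → Vec (Pipe m) n → PipeDream n → Vec (Pipe m) n
traceRows C []           []           = []
traceRows C (top ∷ tops) (row ∷ rows) =
  let C′ , left , bottoms = traceRow C (top ∷ tops) row
  in  left ∷ traceRows C′ bottoms rows

leftLabels : PipeDream n → Vec (Pipe n) n
leftLabels {n} P = traceRows [] (allFin n) P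

HasPermutation : PipeDream n → Permutation′ n → Set
HasPermutation P w = leftLabels P ≡ tabulate (w ⟨$⟩ʳ_)

wtᴾ : PipeDream n → Vec ℕ n
wtᴾ []           = []
wtᴾ (row ∷ rows) = count (cross ≟ᵗ_) row ∷ wtᴾ rows

PD : Permutation′ n → Vec ℕ n → Pred (PipeDream n) _
PD w α P = HasPermutation P w × wtᴾ P ≡ α

-- A subset of [n] × [n], whose cells are numbered row by row.
Region : ℕ → Set
Region n = Subset (n * n)

cell : (i j : Fin n) → Fin (n * n)
cell = combine

-- Irrelevance of the last field makes two grave diagrams equal as soon as
-- their boxes and their ghosts agree.
record GraveDiagram (n : ℕ) : Set where
  constructor grave
  field
    boxes     : Region n
    ghosts    : Region n
    .disjoint : Empty (boxes ∩ ghosts)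

  occupied : Region n
  occupied = boxes ∪ ghosts

open GraveDiagram public

wtᴳ : GraveDiagram n → Vec ℕ n
wtᴳ E = tabulate λ i → ∣ tabulate (λ j → lookup (occupied E) (cell i j)) ∣

IsMax : Pred (Fin n) p → Pred (Fin n) p
IsMax P i = P i × (∀ r → P r → r ≤ i)

module _ (E : GraveDiagram n) where

  RightmostInRow : (i j : Fin n) → Set
  RightmostInRow i j = IsMax (λ k → cell i k ∈ occupied E) j

  LandingRow : (i j i′ : Fin n) → Set
  LandingRow i j i′ = IsMax (λ r → r < i × cell r j ∉ occupied E) i′

  record BoxMovable (i j i′ : Fin n) : Set where
    field
      isBox     : cell i j ∈ boxes E
      rightmost : RightmostInRow i j
      landing   : LandingRow i j i′
      overBoxes : ∀ r → i′ < r → r ≤ i → cell r j ∈ occupied E → cell r j ∈ boxes E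

  record GhostMovable (i j i′ : Fin n) : Set where
    field
      isGhost    : cell i j ∈ ghosts E
      rightmost  : RightmostInRow i j
      landing    : LandingRow i j i′
      overGhosts : ∀ r → i′ < r → r < i → cell r j ∈ occupied E → cell r j ∈ ghosts E

infix 4 _⟶_
data _⟶_ {n} (E F : GraveDiagram n) : Set where

  ordinaryKohnert : ∀ i j i′ → BoxMovable E i j i′ →
    boxes  F ≡ (boxes E - cell i j) ∪ ⁅ cell i′ j ⁆ →
    ghosts F ≡ ghosts E →
    E ⟶ F

  K-Kohnert : ∀ i j i′ → BoxMovable E i j i′ →
    boxes  F ≡ (boxes E - cell i j) ∪ ⁅ cell i′ j ⁆ →
    ghosts F ≡ ghosts E ∪ ⁅ cell i j ⁆ →
    E ⟶ F

  ghostKohnert : ∀ i j i′ → GhostMovable E i j i′ →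
    boxes  F ≡ boxes E →
    ghosts F ≡ (ghosts E - cell i j) ∪ ⁅ cell i′ j ⁆ →
    E ⟶ F

  ghostK-Kohnert : ∀ i j i′ → GhostMovable E i j i′ →
    boxes  F ≡ boxes E →
    ghosts F ≡ ghosts E ∪ ⁅ cell i′ j ⁆ →
    E ⟶ F

rothe : Permutation′ n → Region n
rothe {n} w = tabulate λ c →
  let i , j = remQuot n c
  in  does (i <? (w ⟨$⟩ˡ j) ×-dec j <? (w ⟨$⟩ʳ i))

initial : Permutation′ n → GraveDiagram n
initial w = grave (rothe w) ⊥ λ (_ , x∈) → ∉⊥ (proj₂ (x∈p∩q⁻ (rothe w) ⊥ x∈))

GKKoh : Permutation′ n → Vec ℕ n → Pred (GraveDiagram n) _
GKKoh w α E = Star _⟶_ (initial w) E × wtᴳ E ≡ α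

-- The permutation 142396857 and its inverse 134286975

v : Permutation′ 9
v = permutation (lookup to) (lookup from)
      (from-yes (all? λ i → lookup to (lookup from i) ≟ i))
      (from-yes (all? λ i → lookup from (lookup to i) ≟ i))
  where
  to from : Vec (Fin 9) 9
  to   = # 0 ∷ # 3 ∷ # 1 ∷ # 2 ∷ # 8 ∷ # 5 ∷ # 7 ∷ # 4 ∷ # 6 ∷ []
  from = # 0 ∷ # 2 ∷ # 3 ∷ # 1 ∷ # 7 ∷ # 5 ∷ # 8 ∷ # 6 ∷ # 4 ∷ []

γ : Vec ℕ 9
γ = 4 ∷ 6 ∷ 3 ∷ 3 ∷ 0 ∷ 0 ∷ 0 ∷ 0 ∷ 0 ∷ []

{-# OPTIONS --safe #-}

-- Tracing a row of a pipe dream from the top determines the label at its left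
-- end, so a search that fills the rows one after the other can abandon every
-- branch with a wrong label; this leaves a single pipe dream of weight γ.  The
-- two grave diagrams are each reached by an explicit sequence of moves.
module Submission where

open import Defs
open import Data.Bool as Bool using (if_then_else_)
open import Data.Fin using (Fin; #_; _<?_; _≤?_; _≟_)
open import Data.Fin.Properties using (all?)
open import Data.Fin.Subset using (_∩_; _∪_; _-_; ⁅_⁆)
open import Data.Fin.Subset.Properties using (_∈?_; nonempty?)
open import Data.List using (List; []; _∷_; [_]; _++_; map; concatMap)
open import Data.List.Membership.Propositional using (lose) renaming (_∈_ to _∈ₗ_)
open import Data.List.Membership.Propositional.Properties using (∈-map⁺; ∈-++⁺ˡ; ∈-++⁺ʳ; ∈-concatMap⁺)
open import Data.List.Relation.Unary.All using ([]; _∷_)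
open import Data.List.Relation.Unary.AllPairs using ([]; _∷_)
open import Data.List.Relation.Unary.Any using (here)
open import Data.Maybe using (Maybe; just; nothing; to-witness-T; _>>=_)
open import Data.Nat as ℕ using (ℕ; zero; suc)
open import Data.Product using (∃-syntax; Σ-syntax; _×_; _,_; proj₁; proj₂)
open import Data.Vec using (Vec; []; _∷_; allFin; count)
open import Data.Vec.Properties using (≡-dec)
open import Function using (_∘_; _⇔_; mk⇔)
open import Level using (Level)
open import Relation.Binary.Construct.Closure.ReflexiveTransitive using (Star; ε; _◅_)
open import Relation.Binary.PropositionalEquality using (_≡_; _≢_; refl; cong; subst₂)
open import Relation.Nullary.Decidable using (Dec; yes; no; does; toWitness; toWitnessFalse; map′; dec⇒maybe; dec-true; ¬?; _×-dec_; _→-dec_)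
open import Relation.Unary using (Pred; Decidable)

private
  variable
    p : Level
    m n : ℕ

tileRows : ∀ n → ℕ → List (Vec Tile n)
-- The case split on the number of crosses lives here, so that `tileRows (suc n) k` unfolds for a
-- neutral `k`, such as the `count` of an unknown row.
startingWithCross : ∀ n → ℕ → List (Vec Tile (suc n))

tileRows zero    zero    = [ [] ]
tileRows zero    (suc k) = []
tileRows (suc n) k       = startingWithCross n k ++ map (bump ∷_) (tileRows n k)

startingWithCross n zero    = []
startingWithCross n (suc k) = map (cross ∷_) (tileRows n k)

∈-tileRows : (row : Vec Tile n) → row ∈ₗ tileRows n (count (cross ≟ᵗ_) row)
∈-tileRows []            = here refl
∈-tileRows (cross ∷ row) = ∈-++⁺ˡ (∈-map⁺ (cross ∷_) (∈-tileRows row))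
∈-tileRows {n = suc n} (bump ∷ row) = ∈-++⁺ʳ (startingWithCross n (count (cross ≟ᵗ_) row)) (∈-map⁺ (bump ∷_) (∈-tileRows row))

mutual

  pipeDreams : Crossings m → (tops labels : Vec (Pipe m) n) → Vec ℕ n → List (PipeDream n)
  pipeDreams C [] [] [] = [ [] ]
  pipeDreams {n = suc n} C (top ∷ tops) (label ∷ labels) (k ∷ α) =
    concatMap (pipeDreamsFrom C (top ∷ tops) (label ∷ labels) α) (tileRows n k)

  pipeDreamsFrom : Crossings m → (tops labels : Vec (Pipe m) (suc n)) → Vec ℕ n → Vec Tile n →
                   List (PipeDream (suc n))
  pipeDreamsFrom C tops (label ∷ labels) α row =
    let C′ , left , bottoms = traceRow C tops row
    in  if does (left ≟ label) then map (row ∷_) (pipeDreams C′ bottoms labels α) else []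

-- Completeness of the search. Taking the target labels and weight from `P` itself lets the
-- induction run without equations; `∈-PD⇔` transports the result to `v` and `γ`.
∈-pipeDreams : (C : Crossings m) (tops : Vec (Pipe m) n) (P : PipeDream n) →
               P ∈ₗ pipeDreams C tops (traceRows C tops P) (wtᴾ P)
∈-pipeDreams C []           []        = here refl
∈-pipeDreams C (top ∷ tops) (row ∷ P) = ∈-concatMap⁺ _ (lose (∈-tileRows row) found)
  where
  C′      = proj₁ (traceRow C (top ∷ tops) row)
  left    = proj₁ (proj₂ (traceRow C (top ∷ tops) row))
  bottoms = proj₂ (proj₂ (traceRow C (top ∷ tops) row))

  found : (row ∷ P) ∈ₗ pipeDreamsFrom C (top ∷ tops) (traceRows C (top ∷ tops) (row ∷ P)) (wtᴾ P) row
  -- The first target label is the one traced from `row`, so the pruning test compares `left` with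
  -- itself and keeps the branch.
  found rewrite dec-true (left ≟ left) refl = ∈-map⁺ (row ∷_) (∈-pipeDreams C′ bottoms P)

-- The sole output of the search. Nine of its 16 crosses realise the inversions of `v`; the other
-- seven meet pipes that have already crossed.
thePipeDream : PipeDream 9
thePipeDream =
  (bump  ∷ bump  ∷ cross ∷ bump  ∷ cross ∷ bump  ∷ cross ∷ cross ∷ []) ∷
  (cross ∷ cross ∷ bump  ∷ cross ∷ cross ∷ cross ∷ cross ∷ []) ∷
  (bump  ∷ bump  ∷ cross ∷ cross ∷ bump  ∷ cross ∷ []) ∷
  (bump  ∷ cross ∷ bump  ∷ cross ∷ cross ∷ []) ∷
  (bump  ∷ bump  ∷ bump  ∷ bump  ∷ []) ∷
  (bump  ∷ bump  ∷ bump  ∷ []) ∷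
  (bump  ∷ bump  ∷ []) ∷
  (bump  ∷ []) ∷
  [] ∷
  []

∈-PD⇔ : ∀ P → P ∈ₗ [ thePipeDream ] ⇔ PD v γ P
∈-PD⇔ P = mk⇔
  (λ { (here refl) → refl , refl })
  (λ (labels≡ , wt≡) → subst₂ (λ labels α → P ∈ₗ pipeDreams [] (allFin 9) labels α) labels≡ wt≡
                         (∈-pipeDreams [] (allFin 9) P))

isMax? : {P : Pred (Fin n) p} → Decidable P → Decidable (IsMax P)
isMax? P? i = P? i ×-dec all? λ r → P? r →-dec r ≤? i

module _ (E : GraveDiagram n) (i j i′ : Fin n) where

  rightmostInRow? : Dec (RightmostInRow E i j)
  rightmostInRow? = isMax? (λ k → cell i k ∈? occupied E) j

  landingRow? : Dec (LandingRow E i j i′)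
  landingRow? = isMax? (λ r → r <? i ×-dec ¬? (cell r j ∈? occupied E)) i′

  boxMovable? : Dec (BoxMovable E i j i′)
  boxMovable? = map′
    (λ (b , r , l , o) → record { isBox = b ; rightmost = r ; landing = l ; overBoxes = o })
    (λ M → let open BoxMovable M in isBox , rightmost , landing , overBoxes)
    (cell i j ∈? boxes E ×-dec rightmostInRow? ×-dec landingRow? ×-dec
     all? λ r → i′ <? r →-dec r ≤? i →-dec cell r j ∈? occupied E →-dec cell r j ∈? boxes E)

  ghostMovable? : Dec (GhostMovable E i j i′)
  ghostMovable? = map′
    (λ (g , r , l , o) → record { isGhost = g ; rightmost = r ; landing = l ; overGhosts = o })
    (λ M → let open GhostMovable M in isGhost , rightmost , landing , overGhosts)
    (cell i j ∈? ghosts E ×-dec rightmostInRow? ×-dec landingRow? ×-dec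
     all? λ r → i′ <? r →-dec r <? i →-dec cell r j ∈? occupied E →-dec cell r j ∈? ghosts E)

-- Disjointness after a move is tested case by case instead of being proved in general. The
-- equations returned are those that the constructors of `_⟶_` ask for.
graveDiagram? : (B G : Region n) → Maybe (Σ[ F ∈ GraveDiagram n ] boxes F ≡ B × ghosts F ≡ G)
graveDiagram? {n} B G with nonempty? (B ∩ G)
... | yes _    = nothing
... | no empty = just (grave {n} B G empty , refl , refl)

-- The kind and the row `i` determine a move; recording `j` and `i′` too makes its legality a
-- decision instead of a search.
data Move (n : ℕ) : Set where
  ord K gh ghK : (i j i′ : Fin n) → Move n

move : (E : GraveDiagram n) → Move n → Maybe (∃[ F ] E ⟶ F)
move {n} E (ord i j i′) = do
  movable     ← dec⇒maybe (boxMovable? E i j i′)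
  F , B≡ , G≡ ← graveDiagram? {n} ((boxes E - cell i j) ∪ ⁅ cell i′ j ⁆) (ghosts E)
  just (F , ordinaryKohnert i j i′ movable B≡ G≡)
move {n} E (K i j i′) = do
  movable     ← dec⇒maybe (boxMovable? E i j i′)
  F , B≡ , G≡ ← graveDiagram? {n} ((boxes E - cell i j) ∪ ⁅ cell i′ j ⁆) (ghosts E ∪ ⁅ cell i j ⁆)
  just (F , K-Kohnert i j i′ movable B≡ G≡)
move {n} E (gh i j i′) = do
  movable     ← dec⇒maybe (ghostMovable? E i j i′)
  F , B≡ , G≡ ← graveDiagram? {n} (boxes E) ((ghosts E - cell i j) ∪ ⁅ cell i′ j ⁆)
  just (F , ghostKohnert i j i′ movable B≡ G≡)
move {n} E (ghK i j i′) = do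
  movable     ← dec⇒maybe (ghostMovable? E i j i′)
  F , B≡ , G≡ ← graveDiagram? {n} (boxes E) (ghosts E ∪ ⁅ cell i′ j ⁆)
  just (F , ghostK-Kohnert i j i′ movable B≡ G≡)

-- An illegal move anywhere gives `nothing`, so a `just` certifies the whole sequence.
play : (E : GraveDiagram n) → List (Move n) → Maybe (∃[ F ] Star _⟶_ E F)
play E []       = just (E , ε)
play E (μ ∷ μs) = do
  F , E⟶F  ← move E μ
  G , F⟶*G ← play F μs
  just (G , E⟶F ◅ F⟶*G)

-- The first thirteen moves agree. Each list has seven `K` or `ghK` moves, which raise the 9 cells
-- of the Rothe diagram to the 16 of `γ`. The final diagrams occupy the same cells and differ only
-- in column `# 4`: rows `# 1` and `# 2` hold a box and a ghost in the first, a ghost and a box in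
-- the second.
moves₁ moves₂ : List (Move 9)
moves₁ =
  ord (# 4) (# 7) (# 3) ∷ ord (# 6) (# 6) (# 5) ∷ K (# 5) (# 6) (# 3) ∷
  K (# 1) (# 2) (# 0) ∷ ord (# 4) (# 6) (# 2) ∷ K (# 3) (# 7) (# 2) ∷
  ord (# 6) (# 4) (# 3) ∷ K (# 4) (# 5) (# 3) ∷ ord (# 2) (# 7) (# 1) ∷
  gh (# 3) (# 7) (# 2) ∷ ord (# 1) (# 7) (# 0) ∷ gh (# 5) (# 6) (# 4) ∷
  ord (# 5) (# 4) (# 2) ∷ gh (# 2) (# 7) (# 1) ∷ ord (# 2) (# 6) (# 1) ∷
  ord (# 2) (# 4) (# 1) ∷ ord (# 3) (# 6) (# 2) ∷ ord (# 3) (# 5) (# 2) ∷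
  ord (# 3) (# 4) (# 2) ∷ ord (# 2) (# 6) (# 0) ∷ ghK (# 4) (# 6) (# 3) ∷
  ord (# 2) (# 5) (# 1) ∷ K (# 2) (# 4) (# 0) ∷ gh (# 4) (# 6) (# 2) ∷
  ghK (# 4) (# 5) (# 3) ∷ gh (# 4) (# 5) (# 2) ∷ ord (# 4) (# 4) (# 3) ∷
  []

moves₂ =
  ord (# 4) (# 7) (# 3) ∷ ord (# 6) (# 6) (# 5) ∷ K (# 5) (# 6) (# 3) ∷
  K (# 1) (# 2) (# 0) ∷ ord (# 4) (# 6) (# 2) ∷ K (# 3) (# 7) (# 2) ∷
  ord (# 6) (# 4) (# 3) ∷ K (# 4) (# 5) (# 3) ∷ ord (# 2) (# 7) (# 1) ∷
  gh (# 3) (# 7) (# 2) ∷ ord (# 1) (# 7) (# 0) ∷ gh (# 5) (# 6) (# 4) ∷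
  ord (# 5) (# 4) (# 2) ∷ ord (# 3) (# 6) (# 1) ∷ ord (# 1) (# 6) (# 0) ∷
  ord (# 3) (# 5) (# 2) ∷ ord (# 3) (# 4) (# 1) ∷ ghK (# 4) (# 6) (# 3) ∷
  K (# 1) (# 4) (# 0) ∷ gh (# 2) (# 7) (# 1) ∷ ord (# 2) (# 6) (# 1) ∷
  K (# 2) (# 5) (# 1) ∷ gh (# 4) (# 6) (# 2) ∷ gh (# 4) (# 5) (# 3) ∷
  ord (# 4) (# 4) (# 3) ∷ []

-- Abstract, and decided instead of proved by refl: comparing two of these
-- diagrams up to η, or their weights entry by entry, would replay the moves
-- many times over.
abstract

  reached₁ reached₂ : ∃[ E ] Star _⟶_ (initial v) E
  reached₁ = to-witness-T (play (initial v) moves₁) _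
  reached₂ = to-witness-T (play (initial v) moves₂) _

  weight₁ : wtᴳ (proj₁ reached₁) ≡ γ
  weight₁ = toWitness {a? = ≡-dec ℕ._≟_ (wtᴳ (proj₁ reached₁)) γ} _

  weight₂ : wtᴳ (proj₁ reached₂) ≡ γ
  weight₂ = toWitness {a? = ≡-dec ℕ._≟_ (wtᴳ (proj₁ reached₂)) γ} _

  boxes₁≢boxes₂ : boxes (proj₁ reached₁) ≢ boxes (proj₁ reached₂)
  boxes₁≢boxes₂ =
    toWitnessFalse {a? = ≡-dec Bool._≟_ (boxes (proj₁ reached₁)) (boxes (proj₁ reached₂))} _

proposition3p8 : HasSize (PD v γ) 1 × HasSizeAtLeast (GKKoh v γ) 2
proposition3p8 =
  ([ thePipeDream ] , [] ∷ [] , refl , ∈-PD⇔) ,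
  (proj₁ reached₁ ∷ proj₁ reached₂ ∷ [] ,
   ((boxes₁≢boxes₂ ∘ cong boxes) ∷ []) ∷ [] ∷ [] ,
   refl ,
   (proj₂ reached₁ , weight₁) ∷ (proj₂ reached₂ , weight₂) ∷ [])
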